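{- Let $(b_n(\lambda))_{n\ge 0}$ be the sequence of polynomials in $\lambda$ defined by $b_0(\lambda)=1$ and, for $n\ge 1$, $$b_{n}(\lambda) = -\lambda b_{n-1}(\lambda)-\frac{1}{4}\sum_{i=2}^{n}(-2)^{i}b_{n-i}(\lambda).$$ Then for all $n\ge 0$, $$b_{n}(\lambda) = \sum_{t=0}^{n}\sum_{k=0}^{n}\sum_{\ell=0}^{k}\binom{k}{t}\binom{t}{\ell}(-1)^{k}2^{2k-n+t-2\ell}\left[4\binom{k-t}{2k-n-\ell+1}+\binom{k-t}{2k-n-\ell}\right] \lambda^{t}.$$
   Context: Empty sums are $0$. Binomial coefficients $\binom{a}{b}$ with $a\ge 0$ are $0$ when $b<0$ or $b>a$ (terms with $k<t$ vanish because of the factor $\binom{k}{t}$). Powers of $2$ with negative exponents are rational numbers. -}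

module Defs where

open import Algebra.Bundles.Raw using (RawSemiring)
import Algebra.Definitions.RawSemiring as RawSemiringDefinitions
open import Data.Integer.Base as ℤ using (ℤ; +_; -[1+_])
open import Data.List.Base using (List; []; _∷_; map; foldr; applyUpTo)
open import Data.Nat.Base as ℕ using (ℕ; zero; suc; _∸_)
open import Data.Nat.Combinatorics using (_C_)
open import Data.Rational.Base as ℚ using (ℚ; 0ℚ; 1ℚ; 1/_; _/_)
open import Function.Base using (_∘_)
open import Level using (0ℓ)
open import Relation.Binary.PropositionalEquality using (_≡_; refl; cong; cong₂)

-- A polynomial in λ over ℚ is its list of coefficients, constant term first.
-- Trailing zeros are allowed, so equality of polynomials is _≈ₚ_, not _≡_.

Poly : Set
Poly = List ℚ

coeff : Poly → ℕ → ℚ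
coeff []      _       = 0ℚ
coeff (a ∷ _) zero    = a
coeff (_ ∷ p) (suc m) = coeff p m

infix 4 _≈ₚ_
_≈ₚ_ : Poly → Poly → Set
p ≈ₚ q = ∀ m → coeff p m ≡ coeff q m

infix  8 -ₚ_
infixr 7 _·ₚ_
infixl 7 _*ₚ_
infixl 6 _+ₚ_ _-ₚ_

0ₚ 1ₚ X : Poly
0ₚ = []
1ₚ = 1ℚ ∷ []
X  = 0ℚ ∷ 1ℚ ∷ []

_+ₚ_ : Poly → Poly → Poly
[]      +ₚ q       = q
(a ∷ p) +ₚ []      = a ∷ p
(a ∷ p) +ₚ (c ∷ q) = (a ℚ.+ c) ∷ (p +ₚ q)

-ₚ_ : Poly → Poly
-ₚ p = map ℚ.-_ p

_-ₚ_ : Poly → Poly → Poly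
p -ₚ q = p +ₚ (-ₚ q)

_·ₚ_ : ℚ → Poly → Poly
a ·ₚ p = map (a ℚ.*_) p

_*ₚ_ : Poly → Poly → Poly
[]      *ₚ q = []
(a ∷ p) *ₚ q = a ·ₚ q +ₚ (0ℚ ∷ (p *ₚ q))

poly-rawSemiring : RawSemiring 0ℓ 0ℓ
poly-rawSemiring = record
  { Carrier = Poly
  ; _≈_     = _≈ₚ_
  ; _+_     = _+ₚ_
  ; _*_     = _*ₚ_
  ; 0#      = 0ₚ
  ; 1#      = 1ₚ
  }

open RawSemiringDefinitions poly-rawSemiring public
  using () renaming (_^_ to infixr 8 _^ₚ_)

open RawSemiringDefinitions ℚ.+-*-rawSemiring public
  using () renaming (_^_ to infixr 8 _^ℚ_)

infixr 8 _^ℤ_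
_^ℤ_ : (q : ℚ) .{{_ : ℚ.NonZero q}} → ℤ → ℚ
q ^ℤ (+ n)    = q ^ℚ n
q ^ℤ -[1+ n ] = (1/ q) ^ℚ suc n

fromℕ : ℕ → ℚ
fromℕ n = + n / 1

-- _C_ already vanishes when the lower index exceeds the upper one.
binom : ℕ → ℤ → ℕ
binom a (+ c)    = a C c
binom a -[1+ _ ] = 0

-- The sum of f i over lo ≤ i ≤ hi; it is 0ₚ when hi < lo.
sumₚ : ℕ → ℕ → (ℕ → Poly) → Poly
sumₚ lo hi f = foldr _+ₚ_ 0ₚ (applyUpTo (λ j → f (lo ℕ.+ j)) (suc hi ∸ lo))

infix 5 sumₚ
syntax sumₚ lo hi (λ i → p) = ∑[ i ≔ lo ⋯ hi ] p

-2ℚ ¼ : ℚ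
-2ℚ = -[1+ 1 ] / 1
¼   = + 1 / 4

-- past n j is b (n ∸ j). It is there only to make the course-of-values
-- recursion structural; b-recurrence states the recurrence without it.
mutual
  b : ℕ → Poly
  b zero    = 1ₚ
  b (suc n) = (-ₚ X) *ₚ b n -ₚ ¼ ·ₚ (∑[ i ≔ 2 ⋯ suc n ] (-2ℚ ^ℚ i ·ₚ past n (i ∸ 1)))

  past : ℕ → ℕ → Poly
  past n       zero    = b n
  past zero    (suc _) = 1ₚ
  past (suc n) (suc j) = past n j

past≡b : ∀ n j → past n j ≡ b (n ∸ j)
past≡b n       zero    = refl
past≡b zero    (suc _) = refl
past≡b (suc n) (suc j) = past≡b n j

applyUpTo-cong : ∀ {A : Set} {f g : ℕ → A} → (∀ j → f j ≡ g j) →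
                 ∀ n → applyUpTo f n ≡ applyUpTo g n
applyUpTo-cong f≗g zero    = refl
applyUpTo-cong f≗g (suc n) = cong₂ _∷_ (f≗g 0) (applyUpTo-cong (f≗g ∘ suc) n)

b-recurrence : ∀ n .{{_ : ℕ.NonZero n}} →
  b n ≡ (-ₚ X) *ₚ b (n ∸ 1) -ₚ ¼ ·ₚ (∑[ i ≔ 2 ⋯ n ] (-2ℚ ^ℚ i ·ₚ b (n ∸ i)))
b-recurrence (suc n) =
  cong (λ ps → (-ₚ X) *ₚ b n -ₚ ¼ ·ₚ foldr _+ₚ_ 0ₚ ps)
    (applyUpTo-cong (λ j → cong (-2ℚ ^ℚ (2 ℕ.+ j) ·ₚ_) (past≡b n (suc j))) n)

{-# OPTIONS --safe #-}
module Submission where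

-- The recurrence says that the generating function Σ bₙ xⁿ is
--   (1 + 2 x) / (1 + x (2 + x) + λ x (1 + 2 x)).
-- Expanding it as Σₖ (-x)ᵏ (2 + x + λ (1 + 2 x))ᵏ (1 + 2 x) and extracting the
-- coefficient of λᵗ xⁿ gives the closed form, the index ℓ coming from (1 + 2 x)ᵗ.
-- Here the expansion is replaced by recurrences: the numbers V k t j below satisfy
-- the Pascal rule of the k-th powers, so their alternating sums G obey the two-step
-- recurrence given by the denominator, as do the coefficients of b.

open import Defs
open import Data.Integer.Base as ℤ using (+_)
open import Data.Nat.Base as ℕ using (ℕ; _∸_)
open import Data.Nat.Combinatorics using (_C_)
open import Data.Rational.Base as ℚ using (1ℚ; _/_)

open import Algebra.Bundles using (CommutativeRing)
import Algebra.Properties.Semiring.Sum as SemiringSum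
open import Data.Fin.Base using (toℕ)
open import Data.Fin.Properties using (toℕ-inject₁; toℕ-fromℕ)
open import Data.Integer.Base using (ℤ; -[1+_])
import Data.Integer.Properties as ℤ
open import Data.Integer.Tactic.RingSolver using (solve-∀)
open import Data.List.Base using ([]; _∷_; foldr; applyUpTo)
open import Data.Nat.Base using (zero; suc; _≤_; _<_; z≤n; s≤s)
open import Data.Nat.Combinatorics using (nCk+nC[k+1]≡[n+1]C[k+1]; k>n⇒nCk≡0)
import Data.Nat.Properties as ℕ
import Data.Nat.Solver as ℕSolver
open import Data.Rational.Base using (ℚ; 0ℚ)
import Data.Rational.Properties as ℚ
open import Data.Rational.Solver using (module +-*-Solver)
import Data.Rational.Unnormalised.Base as ℚᵘ
import Data.Rational.Unnormalised.Properties as ℚᵘ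
open import Function.Base using (_∘_)
open import Relation.Binary.PropositionalEquality
  using (_≡_; _≗_; refl; sym; trans; cong; cong₂; module ≡-Reasoning)
open import Relation.Nullary.Decidable using (Dec; yes; no)

open +-*-Solver using (solve; con; _:=_; _:+_; _:*_; :-_)
open SemiringSum (CommutativeRing.semiring ℚ.+-*-commutativeRing)
  using (sum; sum-cong-≗; ∑-distrib-+; *-distribˡ-sum; *-distribʳ-sum;
         sum-init-last; sum-replicate-zero)

-- Finite sums of rationals

2ℚ -1ℚ : ℚ
2ℚ  = + 2 / 1
-1ℚ = ℚ.- 1ℚ

∑< : ℕ → (ℕ → ℚ) → ℚ
∑< n f = sum {n} (f ∘ toℕ)

∑-cong : ∀ n {f g : ℕ → ℚ} → f ≗ g → ∑< n f ≡ ∑< n g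
∑-cong n f≗g = sum-cong-≗ (f≗g ∘ toℕ {n})

∑-+ : ∀ n (f g : ℕ → ℚ) → ∑< n (λ i → f i ℚ.+ g i) ≡ ∑< n f ℚ.+ ∑< n g
∑-+ n f g = ∑-distrib-+ (f ∘ toℕ {n}) (g ∘ toℕ)

*-∑ : ∀ n a (f : ℕ → ℚ) → a ℚ.* ∑< n f ≡ ∑< n (λ i → a ℚ.* f i)
*-∑ n a f = *-distribˡ-sum a (f ∘ toℕ {n})

∑-* : ∀ n a (f : ℕ → ℚ) → ∑< n f ℚ.* a ≡ ∑< n (λ i → f i ℚ.* a)
∑-* n a f = *-distribʳ-sum a (f ∘ toℕ {n})

∑-linear : ∀ n a c (f g : ℕ → ℚ) →
  ∑< n (λ i → a ℚ.* f i ℚ.+ c ℚ.* g i) ≡ a ℚ.* ∑< n f ℚ.+ c ℚ.* ∑< n g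
∑-linear n a c f g = trans (∑-+ n (λ i → a ℚ.* f i) (λ i → c ℚ.* g i))
  (sym (cong₂ ℚ._+_ (*-∑ n a f) (*-∑ n c g)))

∑-last : ∀ n (f : ℕ → ℚ) → ∑< (suc n) f ≡ ∑< n f ℚ.+ f n
∑-last n f = trans (sum-init-last (f ∘ toℕ {suc n}))
  (cong₂ ℚ._+_ (sum-cong-≗ {n} (cong f ∘ toℕ-inject₁)) (cong f (toℕ-fromℕ n)))

∑-zero : ∀ n {f : ℕ → ℚ} → (∀ i → f i ≡ 0ℚ) → ∑< n f ≡ 0ℚ
∑-zero n f≗0 = trans (∑-cong n f≗0) (sum-replicate-zero n)

-- Coefficient sequences of polynomials

-- Multiplication by λ on coefficient sequences.
shift : (ℕ → ℚ) → ℕ → ℚ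
shift f zero    = 0ℚ
shift f (suc m) = f m

shift-cong : ∀ {f g} → f ≗ g → shift f ≗ shift g
shift-cong f≗g zero    = refl
shift-cong f≗g (suc m) = f≗g m

shift-zero : ∀ {f} → (∀ m → f m ≡ 0ℚ) → ∀ m → shift f m ≡ 0ℚ
shift-zero f≗0 zero    = refl
shift-zero f≗0 (suc m) = f≗0 m

shift-∑ : ∀ n (a : ℕ → ℚ) (f : ℕ → ℕ → ℚ) m →
  shift (λ t → ∑< n (λ k → a k ℚ.* f k t)) m ≡ ∑< n (λ k → a k ℚ.* shift (f k) m)
shift-∑ n a f zero    = sym (∑-zero n (λ k → ℚ.*-zeroʳ (a k)))
shift-∑ n a f (suc m) = refl

coeff-+ : ∀ p q m → coeff (p +ₚ q) m ≡ coeff p m ℚ.+ coeff q m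
coeff-+ []      q       m       = sym (ℚ.+-identityˡ (coeff q m))
coeff-+ (a ∷ p) []      m       = sym (ℚ.+-identityʳ (coeff (a ∷ p) m))
coeff-+ (a ∷ p) (c ∷ q) zero    = refl
coeff-+ (a ∷ p) (c ∷ q) (suc m) = coeff-+ p q m

coeff-· : ∀ a p m → coeff (a ·ₚ p) m ≡ a ℚ.* coeff p m
coeff-· a []      m       = sym (ℚ.*-zeroʳ a)
coeff-· a (c ∷ p) zero    = refl
coeff-· a (c ∷ p) (suc m) = coeff-· a p m

coeff-neg : ∀ p m → coeff (-ₚ p) m ≡ ℚ.- coeff p m
coeff-neg []      m       = refl
coeff-neg (a ∷ p) zero    = refl
coeff-neg (a ∷ p) (suc m) = coeff-neg p m

coeff-linear* : ∀ a c p m →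
  coeff ((a ∷ c ∷ []) *ₚ p) m ≡ a ℚ.* coeff p m ℚ.+ c ℚ.* shift (coeff p) m
coeff-linear* a c p zero = trans (coeff-+ (a ·ₚ p) _ 0)
  (cong₂ ℚ._+_ (coeff-· a p 0) (sym (ℚ.*-zeroʳ c)))
coeff-linear* a c p (suc m) = trans (coeff-+ (a ·ₚ p) _ (suc m))
  (cong₂ ℚ._+_ (coeff-· a p (suc m)) (begin
    -- Multiplying by the one-element list `c ∷ []` leaves the summand `0ℚ ∷ []`, a non-empty list
    -- for the zero polynomial.
    coeff (c ·ₚ p +ₚ (0ℚ ∷ [])) m           ≡⟨ coeff-+ (c ·ₚ p) _ m ⟩
    coeff (c ·ₚ p) m ℚ.+ coeff (0ℚ ∷ []) m  ≡⟨ cong₂ ℚ._+_ (coeff-· c p m) (coeff-0∷[] m) ⟩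
    c ℚ.* coeff p m ℚ.+ 0ℚ                  ≡⟨ ℚ.+-identityʳ _ ⟩
    c ℚ.* coeff p m                         ∎))
  where
  open ≡-Reasoning
  coeff-0∷[] : ∀ m → coeff (0ℚ ∷ []) m ≡ 0ℚ
  coeff-0∷[] zero    = refl
  coeff-0∷[] (suc m) = refl

-- The Kronecker delta, built by iterated `shift` so that it follows the recursion of `X ^ₚ t`.
δ : ℕ → ℕ → ℚ
δ zero    zero    = 1ℚ
δ zero    (suc m) = 0ℚ
δ (suc t) m       = shift (δ t) m

coeff-X^ : ∀ t m → coeff (X ^ₚ t) m ≡ δ t m
coeff-X^ zero    zero    = refl
coeff-X^ zero    (suc m) = refl
coeff-X^ (suc t) m       = begin
  coeff (X *ₚ X ^ₚ t) m                                            ≡⟨ coeff-linear* 0ℚ 1ℚ (X ^ₚ t) m ⟩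
  0ℚ ℚ.* coeff (X ^ₚ t) m ℚ.+ 1ℚ ℚ.* shift (coeff (X ^ₚ t)) m  ≡⟨ solve 2 (λ x y → con 0ℚ :* x :+ con 1ℚ :* y := y) refl (coeff (X ^ₚ t) m) _ ⟩
  shift (coeff (X ^ₚ t)) m                                         ≡⟨ shift-cong (coeff-X^ t) m ⟩
  shift (δ t) m                                                    ∎
  where open ≡-Reasoning

-- When m lies outside the range every term is zero, so `f m` has to vanish as well; for the closed
-- form `G-beyond` supplies this.
∑-δ : ∀ n (f : ℕ → ℚ) m → (n ≤ m → f m ≡ 0ℚ) → ∑< n (λ t → f t ℚ.* δ t m) ≡ f m
∑-δ zero    f m       f-vanishes = sym (f-vanishes z≤n)
∑-δ (suc n) f zero    f-vanishes = trans
  (cong₂ ℚ._+_ (ℚ.*-identityʳ (f 0)) (∑-zero n (λ t → ℚ.*-zeroʳ (f (suc t)))))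
  (ℚ.+-identityʳ (f 0))
∑-δ (suc n) f (suc m) f-vanishes = trans
  (cong₂ ℚ._+_ (ℚ.*-zeroʳ (f 0)) (∑-δ n (f ∘ suc) m (f-vanishes ∘ s≤s)))
  (ℚ.+-identityˡ (f (suc m)))

coeff-foldr : ∀ n (f : ℕ → Poly) m →
  coeff (foldr _+ₚ_ 0ₚ (applyUpTo f n)) m ≡ ∑< n (λ i → coeff (f i) m)
coeff-foldr zero    f m = refl
coeff-foldr (suc n) f m = trans (coeff-+ (f 0) _ m) (cong (coeff (f 0) m ℚ.+_) (coeff-foldr n (f ∘ suc) m))

coeff-∑ : ∀ n (f : ℕ → Poly) m → coeff (sumₚ 0 n f) m ≡ ∑< (suc n) (λ i → coeff (f i) m)
coeff-∑ n = coeff-foldr (suc n)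

-- Two-step recurrence for the coefficients of b

tail-coeff : ℕ → ℕ → ℚ
tail-coeff n m = ∑< n (λ j → -2ℚ ^ℚ (2 ℕ.+ j) ℚ.* coeff (past n (suc j)) m)

-- Passing from n to n + 1 brings in the term 4 bₙ and gives each older term one more factor -2,
-- because `past (suc n) (suc (suc j))` reduces to `past n (suc j)`.
tail-coeff-suc : ∀ n m →
  tail-coeff (suc n) m ≡ + 4 / 1 ℚ.* coeff (b n) m ℚ.+ -2ℚ ℚ.* tail-coeff n m
tail-coeff-suc n m = cong (+ 4 / 1 ℚ.* coeff (b n) m ℚ.+_) (trans
  (∑-cong n (λ j → ℚ.*-assoc -2ℚ (-2ℚ ^ℚ (2 ℕ.+ j)) (coeff (past n (suc j)) m)))
  (sym (*-∑ n -2ℚ (λ j → -2ℚ ^ℚ (2 ℕ.+ j) ℚ.* coeff (past n (suc j)) m))))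

b-coeff-suc : ∀ n m →
  coeff (b (suc n)) m ≡ ℚ.- shift (coeff (b n)) m ℚ.+ ℚ.- (¼ ℚ.* tail-coeff n m)
b-coeff-suc n m = trans (coeff-+ ((-ₚ X) *ₚ b n) _ m) (cong₂ ℚ._+_
  (trans (coeff-linear* 0ℚ -1ℚ (b n) m)
    (solve 2 (λ x y → con 0ℚ :* x :+ con -1ℚ :* y := :- y) refl (coeff (b n) m) (shift (coeff (b n)) m)))
  (trans (coeff-neg (¼ ·ₚ S) m) (cong ℚ.-_ (trans (coeff-· ¼ S m) (cong (¼ ℚ.*_)
    (trans (coeff-foldr n (λ j → -2ℚ ^ℚ (2 ℕ.+ j) ·ₚ past n (suc j)) m) (∑-cong n (λ j → coeff-· (-2ℚ ^ℚ (2 ℕ.+ j)) (past n (suc j)) m))))))))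
  where S = ∑[ i ≔ 2 ⋯ suc n ] (-2ℚ ^ℚ i ·ₚ past n (i ∸ 1))

-- The expression -(2 + λ) bₙ₊₁ - (1 + 2 λ) bₙ dictated by the denominator of the generating
-- function. Unit factors are kept so that `∑-linear` matches its shape literally.
step : ℚ → ℚ → ℚ → ℚ → ℚ
step x λx y λy = -1ℚ ℚ.* (2ℚ ℚ.* x ℚ.+ 1ℚ ℚ.* λx) ℚ.+ -1ℚ ℚ.* (1ℚ ℚ.* y ℚ.+ 2ℚ ℚ.* λy)

-- The tail sum is eliminated between the recurrences for b (1 + n) and b (2 + n).
b-coeff-step : ∀ n m → coeff (b (2 ℕ.+ n)) m ≡
  step (coeff (b (suc n)) m) (shift (coeff (b (suc n))) m) (coeff (b n) m) (shift (coeff (b n)) m)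
b-coeff-step n m = begin
  coeff (b (2 ℕ.+ n)) m
    ≡⟨ b-coeff-suc (suc n) m ⟩
  ℚ.- x′ ℚ.+ ℚ.- (¼ ℚ.* tail-coeff (suc n) m)
    ≡⟨ cong (λ s → ℚ.- x′ ℚ.+ ℚ.- (¼ ℚ.* s)) (tail-coeff-suc n m) ⟩
  ℚ.- x′ ℚ.+ ℚ.- (¼ ℚ.* (+ 4 / 1 ℚ.* y ℚ.+ -2ℚ ℚ.* tail-coeff n m))
    ≡⟨ solve 4 (λ x′ y y′ s → :- x′ :+ :- (con ¼ :* (con (+ 4 / 1) :* y :+ con -2ℚ :* s))
         := con -1ℚ :* (con 2ℚ :* (:- y′ :+ :- (con ¼ :* s)) :+ con 1ℚ :* x′)
            :+ con -1ℚ :* (con 1ℚ :* y :+ con 2ℚ :* y′))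
       refl x′ y y′ (tail-coeff n m) ⟩
  step (ℚ.- y′ ℚ.+ ℚ.- (¼ ℚ.* tail-coeff n m)) x′ y y′
    ≡⟨ cong (λ x → step x x′ y y′) (b-coeff-suc n m) ⟨
  step (coeff (b (suc n)) m) x′ y y′ ∎
  where
  open ≡-Reasoning
  x′ = shift (coeff (b (suc n))) m
  y  = coeff (b n) m
  y′ = shift (coeff (b n)) m

-- Powers of two and binomial coefficients with integer indices

fromℕ-+ : ∀ m n → fromℕ (m ℕ.+ n) ≡ fromℕ m ℚ.+ fromℕ n
fromℕ-+ m n = ℚ.toℚᵘ-injective (begin
  ℚ.toℚᵘ (fromℕ (m ℕ.+ n))                 ≈⟨ ℚ.toℚᵘ-fromℚᵘ (ι (m ℕ.+ n)) ⟩
  ι (m ℕ.+ n)                              ≈⟨ ℚᵘ.*≡* (cong (ℤ._* + 1) (cong₂ ℤ._+_ (sym (ℤ.*-identityʳ (+ m))) (sym (ℤ.*-identityʳ (+ n))))) ⟩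
  ι m ℚᵘ.+ ι n                             ≈⟨ ℚᵘ.+-cong (ℚ.toℚᵘ-fromℚᵘ (ι m)) (ℚ.toℚᵘ-fromℚᵘ (ι n)) ⟨
  ℚ.toℚᵘ (fromℕ m) ℚᵘ.+ ℚ.toℚᵘ (fromℕ n)   ≈⟨ ℚ.toℚᵘ-homo-+ (fromℕ m) (fromℕ n) ⟨
  ℚ.toℚᵘ (fromℕ m ℚ.+ fromℕ n)             ∎)
  where
  open ℚᵘ.≃-Reasoning
  ι : ℕ → ℚᵘ.ℚᵘ
  ι k = ℚᵘ.mkℚᵘ (+ k) 0

2^suc : ∀ i → 2ℚ ^ℤ ℤ.suc i ≡ 2ℚ ℚ.* 2ℚ ^ℤ i
2^suc (+ n)        = refl
2^suc -[1+ zero ]  = refl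
2^suc -[1+ suc n ] = solve 1 (λ x → x := con 2ℚ :* (con (+ 1 / 2) :* x)) refl ((+ 1 / 2) ^ℚ suc n)

fromℕ-C-suc : ∀ n k → fromℕ (suc n C suc k) ≡ fromℕ (n C k) ℚ.+ fromℕ (n C suc k)
fromℕ-C-suc n k = trans (cong fromℕ (sym (nCk+nC[k+1]≡[n+1]C[k+1] n k))) (fromℕ-+ (n C k) (n C suc k))

-- With value 0 at negative lower indices, Pascal's rule also holds across the boundary: it reads 1
-- = 1 + 0 at j = -1 and 0 = 0 + 0 below. Hence `H-suc` needs no range conditions.
binom-suc : ∀ c j → binom (suc c) (ℤ.suc j) ≡ binom c (ℤ.suc j) ℕ.+ binom c j
binom-suc c (+ n)        = trans (sym (nCk+nC[k+1]≡[n+1]C[k+1] c n)) (ℕ.+-comm (c C n) _)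
binom-suc c -[1+ zero ]  = refl
binom-suc c -[1+ suc n ] = refl

-- `2ℚ ^ℤ j ℚ.* bracket c j` is the coefficient of y ^ j in (1 + 2 y) ^ c (1 + 2 / y). The 4
-- combines the 2 of 2 / y with the extra 2 in the coefficient of y ^ (j + 1).
bracket : ℕ → ℤ → ℚ
bracket c j = fromℕ (4 ℕ.* binom c (j ℤ.+ + 1) ℕ.+ binom c j)

bracket-suc : ∀ c j → bracket (suc c) (ℤ.suc j) ≡ bracket c (ℤ.suc j) ℚ.+ bracket c j
bracket-suc c j = trans (cong fromℕ nat) (fromℕ-+ (4 ℕ.* binom c (ℤ.suc j ℤ.+ + 1) ℕ.+ binom c (ℤ.suc j)) _)
  where
  open ℕSolver.+-*-Solver using () renaming (solve to ℕsolve; con to κ; _:+_ to _⊕_; _:*_ to _⊗_; _:=_ to _⊜_)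
  upper : binom (suc c) (ℤ.suc j ℤ.+ + 1) ≡ binom c (ℤ.suc j ℤ.+ + 1) ℕ.+ binom c (j ℤ.+ + 1)
  upper rewrite ℤ.+-assoc (+ 1) j (+ 1) = binom-suc c (j ℤ.+ + 1)
  nat : 4 ℕ.* binom (suc c) (ℤ.suc j ℤ.+ + 1) ℕ.+ binom (suc c) (ℤ.suc j)
      ≡ (4 ℕ.* binom c (ℤ.suc j ℤ.+ + 1) ℕ.+ binom c (ℤ.suc j)) ℕ.+ (4 ℕ.* binom c (j ℤ.+ + 1) ℕ.+ binom c j)
  nat = trans (cong₂ (λ x y → 4 ℕ.* x ℕ.+ y) upper (binom-suc c j))
    (ℕsolve 4 (λ w x y z → κ 4 ⊗ (w ⊕ x) ⊕ (y ⊕ z) ⊜ (κ 4 ⊗ w ⊕ y) ⊕ (κ 4 ⊗ x ⊕ z)) refl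
      (binom c (ℤ.suc j ℤ.+ + 1)) (binom c (j ℤ.+ + 1)) (binom c (ℤ.suc j)) (binom c j))

-- Expansion of products of powers of 2 + y and 1 + 2 y

-- The coefficient of y ^ j in (2 + y) ^ a (1 + 2 y) ^ c (1 + 2 / y), where y = 1 / x.
H : ℕ → ℕ → ℤ → ℚ
H zero    c j = 2ℚ ^ℤ j ℚ.* bracket c j
H (suc a) c j = 2ℚ ℚ.* H a c j ℚ.+ H a c (ℤ.pred j)

-- Multiplication by 1 + 2 y. For a = 0 it is Pascal's rule; each further factor 2 + y only combines
-- neighbouring indices linearly, so it commutes with this multiplication.
H-suc : ∀ a c j → H a (suc c) (ℤ.suc j) ≡ H a c (ℤ.suc j) ℚ.+ 2ℚ ℚ.* H a c j
H-suc zero c j = begin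
  2ℚ ^ℤ ℤ.suc j ℚ.* bracket (suc c) (ℤ.suc j)
    ≡⟨ cong₂ ℚ._*_ (2^suc j) (bracket-suc c j) ⟩
  2ℚ ℚ.* p ℚ.* (g′ ℚ.+ g)
    ≡⟨ solve 3 (λ p g′ g → con 2ℚ :* p :* (g′ :+ g) := con 2ℚ :* p :* g′ :+ con 2ℚ :* (p :* g)) refl p g′ g ⟩
  2ℚ ℚ.* p ℚ.* g′ ℚ.+ 2ℚ ℚ.* (p ℚ.* g)
    ≡⟨ cong (λ q → q ℚ.* g′ ℚ.+ 2ℚ ℚ.* (p ℚ.* g)) (2^suc j) ⟨
  2ℚ ^ℤ ℤ.suc j ℚ.* g′ ℚ.+ 2ℚ ℚ.* (p ℚ.* g) ∎
  where
  open ≡-Reasoning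
  p = 2ℚ ^ℤ j
  g = bracket c j
  g′ = bracket c (ℤ.suc j)
H-suc (suc a) c j = begin
  2ℚ ℚ.* H a (suc c) (ℤ.suc j) ℚ.+ H a (suc c) (ℤ.pred (ℤ.suc j))
    ≡⟨ cong (λ i → 2ℚ ℚ.* H a (suc c) (ℤ.suc j) ℚ.+ H a (suc c) i) pred-suc≡suc-pred ⟩
  2ℚ ℚ.* H a (suc c) (ℤ.suc j) ℚ.+ H a (suc c) (ℤ.suc (ℤ.pred j))
    ≡⟨ cong₂ (λ x y → 2ℚ ℚ.* x ℚ.+ y) (H-suc a c j) (H-suc a c (ℤ.pred j)) ⟩
  2ℚ ℚ.* (x ℚ.+ 2ℚ ℚ.* y) ℚ.+ (H a c (ℤ.suc (ℤ.pred j)) ℚ.+ 2ℚ ℚ.* w)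
    ≡⟨ cong (λ i → 2ℚ ℚ.* (x ℚ.+ 2ℚ ℚ.* y) ℚ.+ (H a c i ℚ.+ 2ℚ ℚ.* w)) (sym pred-suc≡suc-pred) ⟩
  2ℚ ℚ.* (x ℚ.+ 2ℚ ℚ.* y) ℚ.+ (z ℚ.+ 2ℚ ℚ.* w)
    ≡⟨ solve 4 (λ x y z w → con 2ℚ :* (x :+ con 2ℚ :* y) :+ (z :+ con 2ℚ :* w)
         := con 2ℚ :* x :+ z :+ con 2ℚ :* (con 2ℚ :* y :+ w)) refl x y z w ⟩
  2ℚ ℚ.* x ℚ.+ z ℚ.+ 2ℚ ℚ.* (2ℚ ℚ.* y ℚ.+ w) ∎
  where
  open ≡-Reasoning
  x = H a c (ℤ.suc j)
  y = H a c j
  z = H a c (ℤ.pred (ℤ.suc j))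
  w = H a c (ℤ.pred j)
  pred-suc≡suc-pred : ℤ.pred (ℤ.suc j) ≡ ℤ.suc (ℤ.pred j)
  pred-suc≡suc-pred = trans (ℤ.pred-suc j) (sym (ℤ.suc-pred j))

-- Choosing y from ℓ of the a factors 2 + y gives 2 ^ (a - ℓ) and leaves y ^ (j - ℓ) to the rest,
-- which gives 2 ^ (j - ℓ) times the bracket; together the exponent is j + a - 2 ℓ.
weight : ℕ → ℕ → ℤ → ℕ → ℚ
weight a c j ℓ = 2ℚ ^ℤ (j ℤ.+ + a ℤ.- + (2 ℕ.* ℓ)) ℚ.* bracket c (j ℤ.- + ℓ)

-- The additional factor 2 + y contributes its 2.
weight-suc : ∀ a c j ℓ → weight (suc a) c j ℓ ≡ 2ℚ ℚ.* weight a c j ℓ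
weight-suc a c j ℓ = trans
  (cong (ℚ._* bracket c (j ℤ.- + ℓ)) (trans (cong (2ℚ ^ℤ_) (eq j (+ a) (+ (2 ℕ.* ℓ)))) (2^suc (j ℤ.+ + a ℤ.- + (2 ℕ.* ℓ)))))
  (ℚ.*-assoc 2ℚ (2ℚ ^ℤ (j ℤ.+ + a ℤ.- + (2 ℕ.* ℓ))) (bracket c (j ℤ.- + ℓ)))
  where
  eq : ∀ j a l → j ℤ.+ (+ 1 ℤ.+ a) ℤ.- l ≡ + 1 ℤ.+ (j ℤ.+ a ℤ.- l)
  eq = solve-∀

-- The additional factor 2 + y contributes its y.
weight-suc-suc : ∀ a c j ℓ → weight (suc a) c j (suc ℓ) ≡ weight a c (ℤ.pred j) ℓ
weight-suc-suc a c j ℓ = cong₂ (λ e i → 2ℚ ^ℤ e ℚ.* bracket c i)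
  (trans (cong (λ l → j ℤ.+ + suc a ℤ.- l) (cong +_ (ℕ.*-suc 2 ℓ))) (eq₁ j (+ a) (+ (2 ℕ.* ℓ))))
  (eq₂ j (+ ℓ))
  where
  eq₁ : ∀ j a l → j ℤ.+ (+ 1 ℤ.+ a) ℤ.- (+ 2 ℤ.+ l) ≡ -[1+ 0 ] ℤ.+ j ℤ.+ a ℤ.- l
  eq₁ = solve-∀
  eq₂ : ∀ j l → j ℤ.- (+ 1 ℤ.+ l) ≡ -[1+ 0 ] ℤ.+ j ℤ.- l
  eq₂ = solve-∀

-- The binomial theorem for (2 + y) ^ a. Any bound L ≥ a is allowed because the closed form sums ℓ
-- up to k instead of t, and because the induction needs two different bounds for the same a.
H-explicit : ∀ L a c j → a ≤ L →
  ∑< (suc L) (λ ℓ → fromℕ (a C ℓ) ℚ.* weight a c j ℓ) ≡ H a c j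
H-explicit L zero c j _ = begin
  1ℚ ℚ.* weight 0 c j 0 ℚ.+ ∑< L (λ ℓ → 0ℚ ℚ.* weight 0 c j (suc ℓ))
    ≡⟨ cong (1ℚ ℚ.* weight 0 c j 0 ℚ.+_) (∑-zero L (λ ℓ → ℚ.*-zeroˡ (weight 0 c j (suc ℓ)))) ⟩
  1ℚ ℚ.* weight 0 c j 0 ℚ.+ 0ℚ
    ≡⟨ trans (ℚ.+-identityʳ _) (ℚ.*-identityˡ (weight 0 c j 0)) ⟩
  weight 0 c j 0
    ≡⟨ cong₂ (λ e i → 2ℚ ^ℤ e ℚ.* bracket c i) (trans (ℤ.+-identityʳ _) (ℤ.+-identityʳ j)) (ℤ.+-identityʳ j) ⟩
  2ℚ ^ℤ j ℚ.* bracket c j ∎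
  where open ≡-Reasoning
H-explicit (suc L) (suc a) c j (s≤s a≤L) = begin
  x₀ ℚ.+ ∑< (suc L) (λ ℓ → fromℕ (suc a C suc ℓ) ℚ.* W (suc ℓ))
    ≡⟨ cong (x₀ ℚ.+_) (trans (∑-cong (suc L) split) (∑-+ (suc L) (λ ℓ → fromℕ (a C suc ℓ) ℚ.* W (suc ℓ)) (λ ℓ → fromℕ (a C ℓ) ℚ.* W (suc ℓ)))) ⟩
  x₀ ℚ.+ (∑< (suc L) (λ ℓ → fromℕ (a C suc ℓ) ℚ.* W (suc ℓ)) ℚ.+ ∑< (suc L) (λ ℓ → fromℕ (a C ℓ) ℚ.* W (suc ℓ)))
    -- Both `suc a C 0` and `a C 0` are 1, so the term at ℓ = 0 completes the first half to a full
    -- sum for a.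
    ≡⟨ ℚ.+-assoc x₀ _ _ ⟨
  ∑< (2 ℕ.+ L) (λ ℓ → fromℕ (a C ℓ) ℚ.* W ℓ) ℚ.+ ∑< (suc L) (λ ℓ → fromℕ (a C ℓ) ℚ.* W (suc ℓ))
    ≡⟨ cong₂ ℚ._+_
         (trans (∑-cong (2 ℕ.+ L) (λ ℓ → trans (cong (fromℕ (a C ℓ) ℚ.*_) (weight-suc a c j ℓ))
           (solve 2 (λ x y → x :* (con 2ℚ :* y) := con 2ℚ :* (x :* y)) refl (fromℕ (a C ℓ)) (weight a c j ℓ))))
           (sym (*-∑ (2 ℕ.+ L) 2ℚ (λ ℓ → fromℕ (a C ℓ) ℚ.* weight a c j ℓ))))
         (∑-cong (suc L) (λ ℓ → cong (fromℕ (a C ℓ) ℚ.*_) (weight-suc-suc a c j ℓ))) ⟩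
  2ℚ ℚ.* ∑< (2 ℕ.+ L) (λ ℓ → fromℕ (a C ℓ) ℚ.* weight a c j ℓ)
    ℚ.+ ∑< (suc L) (λ ℓ → fromℕ (a C ℓ) ℚ.* weight a c (ℤ.pred j) ℓ)
    ≡⟨ cong₂ (λ x y → 2ℚ ℚ.* x ℚ.+ y)
         (H-explicit (suc L) a c j (ℕ.m≤n⇒m≤1+n a≤L)) (H-explicit L a c (ℤ.pred j) a≤L) ⟩
  2ℚ ℚ.* H a c j ℚ.+ H a c (ℤ.pred j) ∎
  where
  open ≡-Reasoning
  W = weight (suc a) c j
  x₀ = 1ℚ ℚ.* W 0
  split : ∀ ℓ → fromℕ (suc a C suc ℓ) ℚ.* W (suc ℓ)
              ≡ fromℕ (a C suc ℓ) ℚ.* W (suc ℓ) ℚ.+ fromℕ (a C ℓ) ℚ.* W (suc ℓ)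
  split ℓ = trans (cong (ℚ._* W (suc ℓ)) (fromℕ-C-suc a ℓ))
    (solve 3 (λ x y w → (x :+ y) :* w := y :* w :+ x :* w) refl (fromℕ (a C ℓ)) (fromℕ (a C suc ℓ)) (W (suc ℓ)))

-- Pascal rule and degree bounds for the k-th powers

-- The coefficient of λ ^ t y ^ j in (1 + 2 y + λ (2 + y)) ^ k (1 + 2 / y).
V : ℕ → ℕ → ℤ → ℚ
V k t j = fromℕ (k C t) ℚ.* H t (k ∸ t) j

V-beyond : ∀ {k t} j → k < t → V k t j ≡ 0ℚ
V-beyond {k} {t} j k<t = trans (cong (λ x → fromℕ x ℚ.* H t (k ∸ t) j) (k>n⇒nCk≡0 k<t)) (ℚ.*-zeroˡ (H t (k ∸ t) j))

-- Multiplication by 1 + 2 y + λ (2 + y). The four products are grouped by their exponent of y, j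
-- first and then j + 1, which is the grouping in `step`.
V-suc : ∀ k t j → V (suc k) t (ℤ.suc j) ≡
  2ℚ ℚ.* V k t j ℚ.+ 1ℚ ℚ.* shift (λ s → V k s j) t
  ℚ.+ (1ℚ ℚ.* V k t (ℤ.suc j) ℚ.+ 2ℚ ℚ.* shift (λ s → V k s (ℤ.suc j)) t)
V-suc k zero j = trans (cong (1ℚ ℚ.*_) (H-suc 0 k j))
  (solve 2 (λ x y → con 1ℚ :* (x :+ con 2ℚ :* y)
    := con 2ℚ :* (con 1ℚ :* y) :+ con 1ℚ :* con 0ℚ :+ (con 1ℚ :* (con 1ℚ :* x) :+ con 2ℚ :* con 0ℚ))
    refl (H 0 k (ℤ.suc j)) (H 0 k j))
V-suc k (suc t) j = begin
  fromℕ (suc k C suc t) ℚ.* h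
    ≡⟨ cong (ℚ._* h) (fromℕ-C-suc k t) ⟩
  (fromℕ (k C t) ℚ.+ fromℕ (k C suc t)) ℚ.* h
    ≡⟨ ℚ.*-distribʳ-+ h (fromℕ (k C t)) (fromℕ (k C suc t)) ⟩
  fromℕ (k C t) ℚ.* h ℚ.+ fromℕ (k C suc t) ℚ.* h
    -- Pascal's rule has separated the two choices from the new factor: `with-λ` removes a factor 2
    -- + y, `without-λ` a factor 1 + 2 y.
    ≡⟨ cong₂ ℚ._+_ with-λ (without-λ (t ℕ.<? k)) ⟩
  fromℕ (k C t) ℚ.* (2ℚ ℚ.* H t (k ∸ t) (ℤ.suc j) ℚ.+ H t (k ∸ t) j) ℚ.+ (V k (suc t) (ℤ.suc j) ℚ.+ 2ℚ ℚ.* V k (suc t) j)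
    ≡⟨ solve 5 (λ f x y z w → f :* (con 2ℚ :* x :+ y) :+ (z :+ con 2ℚ :* w)
         := con 2ℚ :* w :+ con 1ℚ :* (f :* y) :+ (con 1ℚ :* z :+ con 2ℚ :* (f :* x)))
       refl (fromℕ (k C t)) (H t (k ∸ t) (ℤ.suc j)) (H t (k ∸ t) j) (V k (suc t) (ℤ.suc j)) (V k (suc t) j) ⟩
  2ℚ ℚ.* V k (suc t) j ℚ.+ 1ℚ ℚ.* V k t j ℚ.+ (1ℚ ℚ.* V k (suc t) (ℤ.suc j) ℚ.+ 2ℚ ℚ.* V k t (ℤ.suc j)) ∎
  where
  open ≡-Reasoning
  h = H (suc t) (k ∸ t) (ℤ.suc j)
  with-λ : fromℕ (k C t) ℚ.* h ≡ fromℕ (k C t) ℚ.* (2ℚ ℚ.* H t (k ∸ t) (ℤ.suc j) ℚ.+ H t (k ∸ t) j)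
  with-λ = cong (λ i → fromℕ (k C t) ℚ.* (2ℚ ℚ.* H t (k ∸ t) (ℤ.suc j) ℚ.+ H t (k ∸ t) i)) (ℤ.pred-suc j)
  without-λ : Dec (t < k) → fromℕ (k C suc t) ℚ.* h ≡ V k (suc t) (ℤ.suc j) ℚ.+ 2ℚ ℚ.* V k (suc t) j
  without-λ (yes t<k) = begin
    fromℕ (k C suc t) ℚ.* h
      ≡⟨ cong (λ c → fromℕ (k C suc t) ℚ.* H (suc t) c (ℤ.suc j)) (ℕ.+-∸-assoc 1 t<k) ⟩
    fromℕ (k C suc t) ℚ.* H (suc t) (suc (k ∸ suc t)) (ℤ.suc j)
      ≡⟨ cong (fromℕ (k C suc t) ℚ.*_) (H-suc (suc t) (k ∸ suc t) j) ⟩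
    fromℕ (k C suc t) ℚ.* (H (suc t) (k ∸ suc t) (ℤ.suc j) ℚ.+ 2ℚ ℚ.* H (suc t) (k ∸ suc t) j)
      ≡⟨ solve 3 (λ f x y → f :* (x :+ con 2ℚ :* y) := f :* x :+ con 2ℚ :* (f :* y)) refl
           (fromℕ (k C suc t)) (H (suc t) (k ∸ suc t) (ℤ.suc j)) (H (suc t) (k ∸ suc t) j) ⟩
    V k (suc t) (ℤ.suc j) ℚ.+ 2ℚ ℚ.* V k (suc t) j ∎
  -- Here `k ∸ t` is not the successor of `k ∸ suc t`, but the binomial factor makes both sides
  -- zero.
  without-λ (no t≮k) = begin
    fromℕ (k C suc t) ℚ.* h
      ≡⟨ cong (λ x → fromℕ x ℚ.* h) (k>n⇒nCk≡0 k<1+t) ⟩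
    0ℚ ℚ.* h
      ≡⟨ ℚ.*-zeroˡ h ⟩
    0ℚ
      ≡⟨ cong₂ (λ x y → x ℚ.+ 2ℚ ℚ.* y) (V-beyond (ℤ.suc j) k<1+t) (V-beyond j k<1+t) ⟨
    V k (suc t) (ℤ.suc j) ℚ.+ 2ℚ ℚ.* V k (suc t) j ∎
    where
    k<1+t : k < suc t
    k<1+t = s≤s (ℕ.≮⇒≥ t≮k)

-- The product has degree at most k in y. The excess d is arbitrary since `V-suc` refers to two
-- consecutive exponents.
V-above-degree : ∀ k d t → V k t (+ (suc k ℕ.+ d)) ≡ 0ℚ
V-above-degree zero    d zero    = trans (ℚ.*-identityˡ (H 0 0 (+ suc d))) (ℚ.*-zeroʳ (2ℚ ^ℤ + suc d))
V-above-degree zero    d (suc t) = V-beyond {0} {suc t} (+ suc d) (s≤s z≤n)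
V-above-degree (suc k) d t       = trans (V-suc k t (+ (suc k ℕ.+ d)))
  (cong₂ ℚ._+_
    (cong₂ (λ x y → 2ℚ ℚ.* x ℚ.+ 1ℚ ℚ.* y) (lower t) (shift-zero lower t))
    (cong₂ (λ x y → 1ℚ ℚ.* x ℚ.+ 2ℚ ℚ.* y) (upper t) (shift-zero upper t)))
  where
  lower : ∀ s → V k s (+ (suc k ℕ.+ d)) ≡ 0ℚ
  lower = V-above-degree k d
  upper : ∀ s → V k s (+ suc (suc k ℕ.+ d)) ≡ 0ℚ
  upper s = trans (cong (λ i → V k s (+ i)) (sym (ℕ.+-suc (suc k) d))) (V-above-degree k (suc d) s)

-- For k = 0 the product is 1 + 2 / y, which has no power of y below -1.
V₀-below : ∀ n t → V 0 t -[1+ suc n ] ≡ 0ℚ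
V₀-below n zero    = trans (ℚ.*-identityˡ (H 0 0 -[1+ suc n ])) (ℚ.*-zeroʳ (2ℚ ^ℤ -[1+ suc n ]))
V₀-below n (suc t) = V-beyond {0} {suc t} -[1+ suc n ] (s≤s z≤n)

-- Alternating sums and their two-step recurrence

idx : ℕ → ℕ → ℤ
idx k n = + (2 ℕ.* k) ℤ.- + n

idx-suc : ∀ k n → ℤ.suc (idx k (suc n)) ≡ idx k n
idx-suc k n = eq (+ (2 ℕ.* k)) (+ n)
  where
  eq : ∀ k n → + 1 ℤ.+ (k ℤ.- (+ 1 ℤ.+ n)) ≡ k ℤ.- n
  eq = solve-∀

idx-suc-suc : ∀ k n → idx (suc k) (2 ℕ.+ n) ≡ idx k n
idx-suc-suc k n = trans (cong (λ i → + i ℤ.- + (2 ℕ.+ n)) (ℕ.*-suc 2 k)) (eq (+ (2 ℕ.* k)) (+ n))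
  where
  eq : ∀ k n → (+ 2 ℤ.+ k) ℤ.- (+ 2 ℤ.+ n) ≡ k ℤ.- n
  eq = solve-∀

-- At k = n + 1 the exponent 2 k - n equals n + 2, just above the degree k; the right side has the
-- form that `V-above-degree` expects with d = 0.
idx-top : ∀ n → idx (suc n) n ≡ + (suc (suc n) ℕ.+ 0)
idx-top n = begin
  + (2 ℕ.* suc n) ℤ.- + n         ≡⟨ cong (λ i → + i ℤ.- + n) (ℕ.*-suc 2 n) ⟩
  + 2 ℤ.+ + (2 ℕ.* n) ℤ.- + n     ≡⟨ cong (λ i → + 2 ℤ.+ i ℤ.- + n) (ℤ.pos-* 2 n) ⟩
  + 2 ℤ.+ + 2 ℤ.* + n ℤ.- + n     ≡⟨ eq (+ n) ⟩
  + (2 ℕ.+ n)                     ≡⟨ cong +_ (ℕ.+-identityʳ (2 ℕ.+ n)) ⟨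
  + (2 ℕ.+ n ℕ.+ 0)               ∎
  where
  open ≡-Reasoning
  eq : ∀ n → + 2 ℤ.+ + 2 ℤ.* n ℤ.- n ≡ + 2 ℤ.+ n
  eq = solve-∀

sgn : ℕ → ℚ
sgn k = -1ℚ ^ℚ k

-- Setting x = 1 / y turns the k-th term of the expanded generating function into (-1) ^ k y ^ (-2
-- k) times the product behind `V`, so x ^ n corresponds to y ^ (2 k - n). For k > n that exponent
-- exceeds the degree k.
G : ℕ → ℕ → ℚ
G n t = ∑< (suc n) (λ k → sgn k ℚ.* V k t (idx k n))

-- Every k in the sum satisfies k ≤ n < t.
G-beyond : ∀ {n t} → n < t → G n t ≡ 0ℚ
G-beyond {n} {t} n<t = go (suc n) n<t
  where
  go : ∀ N → N ≤ t → ∑< N (λ k → sgn k ℚ.* V k t (idx k n)) ≡ 0ℚ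
  go zero    _   = refl
  go (suc N) N<t = trans (∑-last N (λ k → sgn k ℚ.* V k t (idx k n))) (cong₂ ℚ._+_ (go N (ℕ.<⇒≤ N<t))
    (trans (cong (sgn N ℚ.*_) (V-beyond (idx N n) N<t)) (ℚ.*-zeroʳ (sgn N))))

-- Gives the sum for n the same range of k as the sum for n + 1, so that `G-step` can combine them
-- termwise.
G-extend : ∀ n t → ∑< (2 ℕ.+ n) (λ k → sgn k ℚ.* V k t (idx k n)) ≡ G n t
G-extend n t = trans (∑-last (suc n) (λ k → sgn k ℚ.* V k t (idx k n))) (trans (cong (G n t ℚ.+_)
  (trans (cong (sgn (suc n) ℚ.*_) (trans (cong (V (suc n) t) (idx-top n)) (V-above-degree (suc n) 0 t)))
    (ℚ.*-zeroʳ (sgn (suc n)))))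
  (ℚ.+-identityʳ (G n t)))

G-step : ∀ n m → G (2 ℕ.+ n) m ≡ step (G (suc n) m) (shift (G (suc n)) m) (G n m) (shift (G n) m)
G-step n m = begin
  -- The term k = 0 has exponent -(n + 2) and drops out; the others are indexed by k + 1.
  1ℚ ℚ.* V 0 m -[1+ suc n ] ℚ.+ ∑< N (λ k → sgn (suc k) ℚ.* V (suc k) m (idx (suc k) (2 ℕ.+ n)))
    ≡⟨ cong₂ ℚ._+_ (trans (ℚ.*-identityˡ (V 0 m -[1+ suc n ])) (V₀-below n m)) (∑-cong N term) ⟩
  0ℚ ℚ.+ ∑< N (λ k → step (x k) (x′ k) (y k) (y′ k))
    ≡⟨ ℚ.+-identityˡ _ ⟩
  ∑< N (λ k → step (x k) (x′ k) (y k) (y′ k))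
    ≡⟨ ∑-linear N -1ℚ -1ℚ (λ k → 2ℚ ℚ.* x k ℚ.+ 1ℚ ℚ.* x′ k) (λ k → 1ℚ ℚ.* y k ℚ.+ 2ℚ ℚ.* y′ k) ⟩
  -1ℚ ℚ.* ∑< N (λ k → 2ℚ ℚ.* x k ℚ.+ 1ℚ ℚ.* x′ k) ℚ.+ -1ℚ ℚ.* ∑< N (λ k → 1ℚ ℚ.* y k ℚ.+ 2ℚ ℚ.* y′ k)
    ≡⟨ cong₂ (λ u v → -1ℚ ℚ.* u ℚ.+ -1ℚ ℚ.* v) (∑-linear N 2ℚ 1ℚ x x′) (∑-linear N 1ℚ 2ℚ y y′) ⟩
  step (∑< N x) (∑< N x′) (∑< N y) (∑< N y′)
    ≡⟨ cong₂ (λ u v → step (∑< N x) u (∑< N y) v)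
         (shift-∑ N sgn (λ k s → V k s (idx k (suc n))) m) (shift-∑ N sgn (λ k s → V k s (idx k n)) m) ⟨
  step (G (suc n) m) (shift (G (suc n)) m) (∑< N y) (shift (λ s → ∑< N (λ k → sgn k ℚ.* V k s (idx k n))) m)
    ≡⟨ cong₂ (step (G (suc n) m) (shift (G (suc n)) m)) (G-extend n m) (shift-cong (G-extend n) m) ⟩
  step (G (suc n) m) (shift (G (suc n)) m) (G n m) (shift (G n) m) ∎
  where
  open ≡-Reasoning
  N = 2 ℕ.+ n
  x x′ y y′ : ℕ → ℚ
  x  k = sgn k ℚ.* V k m (idx k (suc n))
  x′ k = sgn k ℚ.* shift (λ s → V k s (idx k (suc n))) m
  y  k = sgn k ℚ.* V k m (idx k n)
  y′ k = sgn k ℚ.* shift (λ s → V k s (idx k n)) m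
  term : ∀ k → sgn (suc k) ℚ.* V (suc k) m (idx (suc k) (2 ℕ.+ n)) ≡ step (x k) (x′ k) (y k) (y′ k)
  term k = trans
    (cong (-1ℚ ℚ.* sgn k ℚ.*_) (begin
      V (suc k) m (idx (suc k) (2 ℕ.+ n))
        -- The exponent 2 k - n is the successor of 2 k - (n + 1), so `V-suc` yields exactly the
        -- exponents occurring in `G n` and `G (suc n)`.
        ≡⟨ cong (V (suc k) m) (trans (idx-suc-suc k n) (sym (idx-suc k n))) ⟩
      V (suc k) m (ℤ.suc j)
        ≡⟨ V-suc k m j ⟩
      2ℚ ℚ.* V k m j ℚ.+ 1ℚ ℚ.* shift (λ s → V k s j) m
        ℚ.+ (1ℚ ℚ.* V k m (ℤ.suc j) ℚ.+ 2ℚ ℚ.* shift (λ s → V k s (ℤ.suc j)) m)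
        ≡⟨ cong (λ i → 2ℚ ℚ.* V k m j ℚ.+ 1ℚ ℚ.* shift (λ s → V k s j) m
             ℚ.+ (1ℚ ℚ.* V k m i ℚ.+ 2ℚ ℚ.* shift (λ s → V k s i) m)) (idx-suc k n) ⟩
      2ℚ ℚ.* V k m j ℚ.+ 1ℚ ℚ.* shift (λ s → V k s j) m
        ℚ.+ (1ℚ ℚ.* V k m i ℚ.+ 2ℚ ℚ.* shift (λ s → V k s i) m) ∎))
    (solve 5 (λ s x x′ y y′ → con -1ℚ :* s :* (con 2ℚ :* x :+ con 1ℚ :* x′ :+ (con 1ℚ :* y :+ con 2ℚ :* y′))
      := con -1ℚ :* (con 2ℚ :* (s :* x) :+ con 1ℚ :* (s :* x′)) :+ con -1ℚ :* (con 1ℚ :* (s :* y) :+ con 2ℚ :* (s :* y′)))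
      refl (sgn k) (V k m j) (shift (λ s → V k s j) m) (V k m i) (shift (λ s → V k s i) m))
    where
    i = idx k n
    j = idx k (suc n)

-- Agreement of b with the alternating sums

b-coeff≡G : ∀ n m → coeff (b n) m ≡ G n m
-- The recurrence has order two, so b₀ = 1 and b₁ = -λ are checked directly: coefficients up to the
-- degree by computation, higher ones by `G-beyond`.
b-coeff≡G zero          zero          = refl
b-coeff≡G zero          (suc m)       = sym (G-beyond {0} {suc m} (s≤s z≤n))
b-coeff≡G (suc zero)    zero          = refl
b-coeff≡G (suc zero)    (suc zero)    = refl
b-coeff≡G (suc zero)    (suc (suc m)) = sym (G-beyond {1} {2 ℕ.+ m} (s≤s (s≤s z≤n)))
b-coeff≡G (suc (suc n)) m             = begin
  coeff (b (2 ℕ.+ n)) m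
    ≡⟨ b-coeff-step n m ⟩
  step (coeff (b (suc n)) m) (shift (coeff (b (suc n))) m) (coeff (b n) m) (shift (coeff (b n)) m)
    ≡⟨ cong₂ (λ u v → step u v (coeff (b n) m) (shift (coeff (b n)) m))
         (b-coeff≡G (suc n) m) (shift-cong (b-coeff≡G (suc n)) m) ⟩
  step (G (suc n) m) (shift (G (suc n)) m) (coeff (b n) m) (shift (coeff (b n)) m)
    ≡⟨ cong₂ (step (G (suc n) m) (shift (G (suc n)) m)) (b-coeff≡G n m) (shift-cong (b-coeff≡G n) m) ⟩
  step (G (suc n) m) (shift (G (suc n)) m) (G n m) (shift (G n) m)
    ≡⟨ G-step n m ⟨
  G (2 ℕ.+ n) m ∎
  where open ≡-Reasoning

-- Collapsing the triple sum

summand : ℕ → ℕ → ℕ → ℕ → ℚ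
summand n t k ℓ =
  fromℕ (k C t) ℚ.* fromℕ (t C ℓ)
    ℚ.* (ℚ.- 1ℚ) ^ℚ k
    ℚ.* (+ 2 / 1) ^ℤ (+ (2 ℕ.* k) ℤ.- + n ℤ.+ + t ℤ.- + (2 ℕ.* ℓ))
    ℚ.* fromℕ (4 ℕ.* binom (k ∸ t) (+ (2 ℕ.* k) ℤ.- + n ℤ.- + ℓ ℤ.+ + 1)
      ℕ.+ binom (k ∸ t) (+ (2 ℕ.* k) ℤ.- + n ℤ.- + ℓ))

-- Once the factors free of ℓ are pulled out, the sum over ℓ is the binomial expansion in
-- `H-explicit` with a = t and L = k.
∑-summand : ∀ n t k → ∑< (suc k) (summand n t k) ≡ sgn k ℚ.* V k t (idx k n)
∑-summand n t k = begin
  ∑< (suc k) (summand n t k)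
    ≡⟨ ∑-cong (suc k) (λ ℓ → solve 5 (λ c d s p g → c :* d :* s :* p :* g := s :* c :* (d :* (p :* g))) refl
         (fromℕ (k C t)) (fromℕ (t C ℓ)) (sgn k) (2ℚ ^ℤ (idx k n ℤ.+ + t ℤ.- + (2 ℕ.* ℓ))) (bracket (k ∸ t) (idx k n ℤ.- + ℓ))) ⟩
  ∑< (suc k) (λ ℓ → sgn k ℚ.* fromℕ (k C t) ℚ.* T ℓ)
    ≡⟨ *-∑ (suc k) (sgn k ℚ.* fromℕ (k C t)) T ⟨
  sgn k ℚ.* fromℕ (k C t) ℚ.* ∑< (suc k) T
    ≡⟨ ℚ.*-assoc (sgn k) (fromℕ (k C t)) _ ⟩
  sgn k ℚ.* (fromℕ (k C t) ℚ.* ∑< (suc k) T)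
    ≡⟨ cong (sgn k ℚ.*_) (closed (t ℕ.≤? k)) ⟩
  sgn k ℚ.* V k t (idx k n) ∎
  where
  open ≡-Reasoning
  T : ℕ → ℚ
  T ℓ = fromℕ (t C ℓ) ℚ.* weight t (k ∸ t) (idx k n) ℓ
  closed : Dec (t ≤ k) → fromℕ (k C t) ℚ.* ∑< (suc k) T ≡ V k t (idx k n)
  closed (yes t≤k) = cong (fromℕ (k C t) ℚ.*_) (H-explicit k t (k ∸ t) (idx k n) t≤k)
  -- `H-explicit` needs t ≤ k; otherwise `k C t` annihilates both sides.
  closed (no  t≰k) = trans
    (trans (cong (λ x → fromℕ x ℚ.* ∑< (suc k) T) (k>n⇒nCk≡0 (ℕ.≰⇒> t≰k))) (ℚ.*-zeroˡ (∑< (suc k) T)))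
    (sym (V-beyond (idx k n) (ℕ.≰⇒> t≰k)))

theorem17 : ∀ (n : ℕ) →
    b n ≈ₚ
    (∑[ t ≔ 0 ⋯ n ] ∑[ k ≔ 0 ⋯ n ] ∑[ ℓ ≔ 0 ⋯ k ]
    ((fromℕ (k C t) ℚ.* fromℕ (t C ℓ)
    ℚ.* (ℚ.- 1ℚ) ^ℚ k
    ℚ.* (+ 2 / 1) ^ℤ (+ (2 ℕ.* k) ℤ.- + n ℤ.+ + t ℤ.- + (2 ℕ.* ℓ))
    ℚ.* fromℕ (4 ℕ.* binom (k ∸ t) (+ (2 ℕ.* k) ℤ.- + n ℤ.- + ℓ ℤ.+ + 1)
    ℕ.+ binom (k ∸ t) (+ (2 ℕ.* k) ℤ.- + n ℤ.- + ℓ)))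
    ·ₚ X ^ₚ t))
theorem17 n m = sym (begin
  coeff (∑[ t ≔ 0 ⋯ n ] ∑[ k ≔ 0 ⋯ n ] ∑[ ℓ ≔ 0 ⋯ k ] (summand n t k ℓ ·ₚ X ^ₚ t)) m
    ≡⟨ coeff-∑ n (λ t → ∑[ k ≔ 0 ⋯ n ] ∑[ ℓ ≔ 0 ⋯ k ] (summand n t k ℓ ·ₚ X ^ₚ t)) m ⟩
  ∑< (suc n) (λ t → coeff (∑[ k ≔ 0 ⋯ n ] ∑[ ℓ ≔ 0 ⋯ k ] (summand n t k ℓ ·ₚ X ^ₚ t)) m)
    ≡⟨ ∑-cong (suc n) inner ⟩
  ∑< (suc n) (λ t → G n t ℚ.* δ t m)
    -- Only t = m contributes to the coefficient of λ ^ m; for m > n both sides are zero.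
    ≡⟨ ∑-δ (suc n) (G n) m G-beyond ⟩
  G n m
    ≡⟨ b-coeff≡G n m ⟨
  coeff (b n) m ∎)
  where
  open ≡-Reasoning
  innermost : ∀ t k → coeff (∑[ ℓ ≔ 0 ⋯ k ] (summand n t k ℓ ·ₚ X ^ₚ t)) m ≡ sgn k ℚ.* V k t (idx k n) ℚ.* δ t m
  innermost t k = begin
    coeff (∑[ ℓ ≔ 0 ⋯ k ] (summand n t k ℓ ·ₚ X ^ₚ t)) m
      ≡⟨ coeff-∑ k (λ ℓ → summand n t k ℓ ·ₚ X ^ₚ t) m ⟩
    ∑< (suc k) (λ ℓ → coeff (summand n t k ℓ ·ₚ X ^ₚ t) m)
      ≡⟨ ∑-cong (suc k) (λ ℓ → trans (coeff-· (summand n t k ℓ) (X ^ₚ t) m) (cong (summand n t k ℓ ℚ.*_) (coeff-X^ t m))) ⟩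
    ∑< (suc k) (λ ℓ → summand n t k ℓ ℚ.* δ t m)
      ≡⟨ ∑-* (suc k) (δ t m) (summand n t k) ⟨
    ∑< (suc k) (summand n t k) ℚ.* δ t m
      ≡⟨ cong (ℚ._* δ t m) (∑-summand n t k) ⟩
    sgn k ℚ.* V k t (idx k n) ℚ.* δ t m ∎
  inner : ∀ t → coeff (∑[ k ≔ 0 ⋯ n ] ∑[ ℓ ≔ 0 ⋯ k ] (summand n t k ℓ ·ₚ X ^ₚ t)) m ≡ G n t ℚ.* δ t m
  inner t = trans (coeff-∑ n (λ k → ∑[ ℓ ≔ 0 ⋯ k ] (summand n t k ℓ ·ₚ X ^ₚ t)) m) (trans (∑-cong (suc n) (innermost t))
    (sym (∑-* (suc n) (δ t m) (λ k → sgn k ℚ.* V k t (idx k n)))))
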